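{- For every integer $k\ge 2$ and every $n\ge 8k^2$, $$\alpha_1(KG(n,k))=\binom{n-1}{k-1}+1.$$ Furthermore, for such $k$ and $n$, if $\mathcal{F}\subseteq\binom{[n]}{k}$ is a robust independent family in $KG(n,k)$ such that for every $x\in[n]$ there exist two distinct sets $F_x,G_x\in\mathcal{F}$ with $x\notin F_x$ and $x\notin G_x$, then $|\mathcal{F}|\le 8k\binom{n-2}{k-2}$.
   Context: For integers $k\ge 2$, $n\ge 2k$, the Kneser graph $KG(n,k)$ has vertex set $\binom{[n]}{k}$ (the $k$-element subsets of $[n]=\{1,\dots,n\}$), two sets being adjacent iff they are disjoint. A 1-selection of a graph $G=(V,E)$ is a map $f$ assigning to each vertex $v$ a set $f(v)$ of at most one edge incident with $v$; the 1-removed subgraph $G_f$ has vertex set $V$ and edge set $E\setminus\bigcup_{v}f(v)$. A set $U\subseteq V$ is robust independent if there is a 1-selection $f$ such that $U$ is independent in $G_f$. The robust independence number is $\alpha_1(G)=\max_f\alpha(G_f)$ over all 1-selections $f$. -}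

module Defs where

open import Data.Nat using (ℕ; _≤_)
open import Data.Fin using (Fin)
open import Data.Fin.Subset using (Subset; ∣_∣; _∩_; Empty)
open import Data.Maybe using (Maybe; just)
open import Data.List using (List; length)
open import Data.List.Membership.Propositional using (_∈_)
open import Data.List.Relation.Unary.All using (All)
open import Data.List.Relation.Unary.Unique.Propositional using (Unique)
open import Data.Product using (Σ; _×_)
open import Data.Sum using (_⊎_)
open import Relation.Binary.PropositionalEquality using (_≡_)

IsVertex : (n k : ℕ) → Subset n → Set
IsVertex n k s = ∣ s ∣ ≡ k

Adjacent : (n k : ℕ) → Subset n → Subset n → Set
Adjacent n k u v = IsVertex n k u × IsVertex n k v × Empty (u ∩ v)

-- A 1-selection: each vertex v selects at most one incident edge,
-- encoded as  sel v ≡ just w  meaning the edge {v,w} is selected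
-- (nothing means the empty set).
record OneSelection (n k : ℕ) : Set where
  field
    sel   : Subset n → Maybe (Subset n)
    valid : ∀ v w → IsVertex n k v → sel v ≡ just w → Adjacent n k v w
open OneSelection public

Removed : ∀ {n k} → OneSelection n k → Subset n → Subset n → Set
Removed f u v = sel f u ≡ just v ⊎ sel f v ≡ just u

IsFamily : (n k : ℕ) → List (Subset n) → Set
IsFamily n k U = Unique U × All (IsVertex n k) U

IndependentIn : ∀ {n k} → OneSelection n k → List (Subset n) → Set
IndependentIn {n} {k} f U =
  ∀ u v → u ∈ U → v ∈ U → Adjacent n k u v → Removed f u v

RobustIndependent : (n k : ℕ) → List (Subset n) → Set
RobustIndependent n k U = Σ (OneSelection n k) λ f → IndependentIn f U

-- α₁(KG(n,k)) = m : m = max_f α(G_f), i.e. m is the maximum size of a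
-- robust independent family (attained, and an upper bound).
α₁KG≡ : (n k m : ℕ) → Set
α₁KG≡ n k m =
  (Σ (List (Subset n)) λ U → IsFamily n k U × RobustIndependent n k U × length U ≡ m)
  × (∀ U → IsFamily n k U → RobustIndependent n k U → length U ≤ m)

{-# OPTIONS --safe #-}
module Submission where

-- If some x is missed by at most one member, the family is a star plus at most one set;
-- otherwise the second claim applies, and 8k C(n-2,k-2) ≤ C(n-1,k-1).  For the second
-- claim, write M = C(n-2,k-2).  The selected
-- edges induce on every subfamily at most as many edges as vertices, so F contains an
-- intersecting family I with |F| ≤ 3|I|.  If I is a star at x, two members of F missing x
-- give |I| ≤ 2kM + 1.  Otherwise I is peeled: an intersecting family S of sets of size ≤ t
-- generating I is shrunk until every S-member of size t is inclusion-minimal as a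
-- transversal of S; branching then shows that there are at most t^t such members, and
-- they account for at most t^t C(n-t,k-t) sets of I.  Since n ≥ 8k², these terms decay
-- geometrically from t = 3 on, while t = 2 contributes at most max(k,4) M.

open import Defs
open import Data.Nat using (ℕ; zero; suc; _+_; _*_; _∸_; _^_; _≤_; _<_; _⊔_; z≤n; s≤s; s≤s⁻¹; _≤?_; _≟_)
open import Data.Nat.Properties hiding (_≟_)
open import Data.Nat.Combinatorics using (_C_; nC1≡n; nCk+nC[k+1]≡[n+1]C[k+1])
open import Data.Nat.Tactic.RingSolver using (solve-∀)
open import Data.Bool.Properties using () renaming (_≟_ to _≟ᵇ_)
open import Data.Fin using (Fin; zero; suc)
import Data.Fin.Properties as Fin
open import Data.Fin.Subset using (Subset; inside; outside; ⊥; ⁅_⁆; _∉_; _⊆_; _∩_; _∪_; _-_; ∣_∣; Nonempty; Empty)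
  renaming (_∈_ to _∈ₛ_)
open import Data.Fin.Subset.Properties
open import Data.List using (List; []; _∷_; _++_; length; map; concatMap; filter; fromMaybe)
open import Data.List.Properties using (length-map; length-++; filter-notAll; filter-reject)
open import Data.List.Membership.Propositional using (_∈_; lose; find)
open import Data.List.Membership.Propositional.Properties
open import Data.List.Relation.Unary.Any as Any using (Any; here; there; any?)
open import Data.List.Relation.Unary.All as All using (All; []; _∷_; all?)
import Data.List.Relation.Unary.All.Properties as All
open import Data.List.Relation.Unary.AllPairs using ([]; _∷_)
open import Data.List.Relation.Unary.Unique.Propositional using (Unique)
import Data.List.Relation.Unary.Unique.Propositional.Properties as Unique
open import Data.Maybe using (Maybe; just; nothing)
open import Data.Maybe.Properties as Maybe using (just-injective)
open import Data.Vec using ([]; _∷_; here; there)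
open import Data.Vec.Properties using (∷-injectiveˡ; ∷-injectiveʳ; ≡-dec)
open import Data.Product using (Σ; ∃; _×_; _,_; proj₁; proj₂)
open import Data.Sum using (_⊎_; inj₁; inj₂)
open import Function using (_∘_)
import Level
open import Relation.Nullary using (¬_; Dec; yes; no; ¬?; contradiction; _×-dec_)
open import Relation.Unary using (Pred; Decidable)
open import Relation.Binary using (DecidableEquality)
open import Relation.Binary.PropositionalEquality using (_≡_; _≢_; refl; sym; trans; cong; cong₂; subst; module ≡-Reasoning)

private
  variable
    A B : Set
    n : ℕ

-- Counting supersets of a given set

length-concatMap-≤ : (f : A → List B) (m : ℕ) (xs : List A) →
  (∀ x → x ∈ xs → length (f x) ≤ m) → length (concatMap f xs) ≤ length xs * m
length-concatMap-≤ f m [] h = z≤n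
length-concatMap-≤ f m (x ∷ xs) h rewrite length-++ (f x) {concatMap f xs} =
  +-mono-≤ (h x (here refl)) (length-concatMap-≤ f m xs (λ y → h y ∘ there))

length-unique-⊆ : {xs ys : List A} → Unique xs → (∀ {x} → x ∈ xs → x ∈ ys) →
  length xs ≤ length ys
length-unique-⊆ {xs = []} _ _ = z≤n
length-unique-⊆ {xs = x ∷ xs} (x≢ ∷ u) sub with ∈-∃++ (sub (here refl))
... | as , bs , refl = ≤-trans (s≤s (length-unique-⊆ u sub′)) (≤-reflexive (sym eq))
  where
  eq : length (as ++ x ∷ bs) ≡ suc (length (as ++ bs))
  eq = trans (length-++ as) (trans (+-suc _ _) (cong suc (sym (length-++ as))))
  sub′ : ∀ {y} → y ∈ xs → y ∈ as ++ bs
  sub′ {y} y∈ with ∈-++⁻ as (sub (there y∈))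
  ... | inj₁ y∈as = ∈-++⁺ˡ y∈as
  ... | inj₂ (here y≡x) = contradiction (sym y≡x) (All.lookup x≢ y∈)
  ... | inj₂ (there y∈bs) = ∈-++⁺ʳ as y∈bs

length-split : {P : Pred A Level.zero} (P? : Decidable P) (xs : List A) →
  length xs ≡ length (filter P? xs) + length (filter (¬? ∘ P?) xs)
length-split P? [] = refl
length-split P? (x ∷ xs) with P? x
... | yes _ = cong suc (length-split P? xs)
... | no _ = trans (cong suc (length-split P? xs)) (sym (+-suc _ _))

-- Pascal's rule splits the left side. The induction hypothesis handles `suc k * b` and the multiple
-- of `c`, and the spare copy of `b` raises the factor `suc n` by one.
absorption : ∀ n k → suc k * (suc n C suc k) ≡ suc n * (n C k)
absorption n zero = trans (+-identityʳ _) (trans (nC1≡n (suc n)) (sym (*-identityʳ _)))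
absorption zero (suc k) = *-zeroʳ (suc (suc k))
absorption (suc n) (suc k) = begin
  suc (suc k) * (suc (suc n) C suc (suc k))
    ≡⟨ cong (suc (suc k) *_) (sym (nCk+nC[k+1]≡[n+1]C[k+1] (suc n) (suc k))) ⟩
  suc (suc k) * (b + c)
    ≡⟨ expand (suc k) b c ⟩
  b + suc k * b + suc (suc k) * c
    ≡⟨ cong₂ (λ u v → b + u + v) (absorption n k) (absorption n (suc k)) ⟩
  b + suc n * (n C k) + suc n * (n C suc k)
    ≡⟨ collect (suc n) b (n C k) (n C suc k) ⟩
  b + suc n * (n C k + n C suc k)
    ≡⟨ cong (λ u → b + suc n * u) (nCk+nC[k+1]≡[n+1]C[k+1] n k) ⟩
  suc (suc n) * b ∎
  where
  open ≡-Reasoning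
  b = suc n C suc k
  c = suc n C suc (suc k)
  expand : ∀ k b c → suc k * (b + c) ≡ b + k * b + suc k * c
  expand = solve-∀
  collect : ∀ n b c d → b + n * c + n * d ≡ b + n * (c + d)
  collect = solve-∀

-- By absorption, raising both arguments by one multiplies the binomial by `suc n / suc k`. This is
-- what turns n ≥ 8k² into a factor 8k per step.
C-step-≤ : ∀ c n k → c * suc k ≤ suc n → c * (n C k) ≤ suc n C suc k
C-step-≤ c n k le = *-cancelˡ-≤ (suc k) (begin
  suc k * (c * (n C k))   ≡⟨ shuffle (suc k) c (n C k) ⟩
  c * suc k * (n C k)     ≤⟨ *-monoˡ-≤ (n C k) le ⟩
  suc n * (n C k)         ≡⟨ sym (absorption n k) ⟩
  suc k * (suc n C suc k) ∎)
  where
  open ≤-Reasoning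
  shuffle : ∀ a b c → a * (b * c) ≡ b * a * c
  shuffle = solve-∀

C-positive : ∀ {n k} → k ≤ n → 1 ≤ n C k
C-positive z≤n = ≤-refl
C-positive {suc n} {suc k} (s≤s k≤n) = ≤-trans (C-positive k≤n)
  (≤-trans (m≤m+n _ _) (≤-reflexive (nCk+nC[k+1]≡[n+1]C[k+1] n k)))

elements : Subset n → List (Fin n)
elements [] = []
elements (inside ∷ p) = zero ∷ map suc (elements p)
elements (outside ∷ p) = map suc (elements p)

length-elements : (p : Subset n) → length (elements p) ≡ ∣ p ∣
length-elements [] = refl
length-elements (inside ∷ p) = cong suc (trans (length-map suc (elements p)) (length-elements p))
length-elements (outside ∷ p) = trans (length-map suc (elements p)) (length-elements p)

∈-elements⁺ : {x : Fin n} {p : Subset n} → x ∈ₛ p → x ∈ elements p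
∈-elements⁺ {p = inside ∷ p} here = here refl
∈-elements⁺ {p = inside ∷ p} (there x∈) = there (∈-map⁺ suc (∈-elements⁺ x∈))
∈-elements⁺ {p = outside ∷ p} (there x∈) = ∈-map⁺ suc (∈-elements⁺ x∈)

∈-elements⁻ : {x : Fin n} (p : Subset n) → x ∈ elements p → x ∈ₛ p
∈-elements⁻ (inside ∷ p) (here refl) = here
∈-elements⁻ (inside ∷ p) (there x∈) with ∈-map⁻ suc x∈
... | _ , y∈ , refl = there (∈-elements⁻ p y∈)
∈-elements⁻ (outside ∷ p) x∈ with ∈-map⁻ suc x∈
... | _ , y∈ , refl = there (∈-elements⁻ p y∈)

-- `j` counts the added elements: these are the supersets of `p` of size `∣ p ∣ + j`.
extensions : Subset n → ℕ → List (Subset n)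
extensions [] zero = [] ∷ []
extensions [] (suc j) = []
extensions (inside ∷ p) j = map (inside ∷_) (extensions p j)
extensions (outside ∷ p) zero = map (outside ∷_) (extensions p zero)
extensions (outside ∷ p) (suc j) =
  map (inside ∷_) (extensions p j) ++ map (outside ∷_) (extensions p (suc j))

length-extensions : (p : Subset n) (j : ℕ) → length (extensions p j) ≡ (n ∸ ∣ p ∣) C j
length-extensions [] zero = refl
length-extensions [] (suc j) = refl
length-extensions (inside ∷ p) j = trans (length-map _ (extensions p j)) (length-extensions p j)
length-extensions (outside ∷ p) zero = trans (length-map _ (extensions p 0)) (length-extensions p 0)
length-extensions {suc n} (outside ∷ p) (suc j) = begin
  length (map (inside ∷_) (extensions p j) ++ map (outside ∷_) (extensions p (suc j)))
    ≡⟨ length-++ (map (inside ∷_) (extensions p j)) ⟩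
  length (map (inside ∷_) (extensions p j)) + length (map (outside ∷_) (extensions p (suc j)))
    ≡⟨ cong₂ _+_ (trans (length-map _ (extensions p j)) (length-extensions p j))
                 (trans (length-map _ (extensions p (suc j))) (length-extensions p (suc j))) ⟩
  (n ∸ ∣ p ∣) C j + (n ∸ ∣ p ∣) C suc j
    ≡⟨ nCk+nC[k+1]≡[n+1]C[k+1] (n ∸ ∣ p ∣) j ⟩
  suc (n ∸ ∣ p ∣) C suc j
    ≡⟨ cong (_C suc j) (sym (+-∸-assoc 1 (∣p∣≤n p))) ⟩
  (suc n ∸ ∣ p ∣) C suc j ∎
  where open ≡-Reasoning

∈-extensions⁺ : (p a : Subset n) (j : ℕ) → p ⊆ a → ∣ a ∣ ≡ ∣ p ∣ + j → a ∈ extensions p j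
∈-extensions⁺ [] [] zero _ _ = here refl
∈-extensions⁺ (inside ∷ p) (inside ∷ a) j p⊆a eq =
  ∈-map⁺ _ (∈-extensions⁺ p a j (drop-∷-⊆ p⊆a) (suc-injective eq))
∈-extensions⁺ (inside ∷ p) (outside ∷ a) j p⊆a eq with p⊆a here
... | ()
∈-extensions⁺ (outside ∷ p) (inside ∷ a) zero p⊆a eq =
  contradiction (≤-trans (≤-reflexive (trans eq (+-identityʳ _))) (p⊆q⇒∣p∣≤∣q∣ {p = p} {q = a} (drop-∷-⊆ p⊆a))) 1+n≰n
∈-extensions⁺ (outside ∷ p) (outside ∷ a) zero p⊆a eq =
  ∈-map⁺ _ (∈-extensions⁺ p a zero (drop-∷-⊆ p⊆a) eq)
∈-extensions⁺ (outside ∷ p) (inside ∷ a) (suc j) p⊆a eq =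
  ∈-++⁺ˡ (∈-map⁺ _ (∈-extensions⁺ p a j (drop-∷-⊆ p⊆a) (suc-injective (trans eq (+-suc _ j)))))
∈-extensions⁺ (outside ∷ p) (outside ∷ a) (suc j) p⊆a eq =
  ∈-++⁺ʳ (map (inside ∷_) (extensions p j)) (∈-map⁺ _ (∈-extensions⁺ p a (suc j) (drop-∷-⊆ p⊆a) eq))

∈-extensions⁻ : (p a : Subset n) (j : ℕ) → a ∈ extensions p j → p ⊆ a × ∣ a ∣ ≡ ∣ p ∣ + j
∈-extensions⁻ [] .[] zero (here refl) = (λ x∈ → x∈) , refl
∈-extensions⁻ (inside ∷ p) a j a∈ with ∈-map⁻ _ a∈
... | b , b∈ , refl with ∈-extensions⁻ p b j b∈
... | p⊆b , eq = in⊆in p⊆b , cong suc eq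
∈-extensions⁻ (outside ∷ p) a zero a∈ with ∈-map⁻ _ a∈
... | b , b∈ , refl with ∈-extensions⁻ p b zero b∈
... | p⊆b , eq = out⊆ p⊆b , eq
∈-extensions⁻ (outside ∷ p) a (suc j) a∈ with ∈-++⁻ (map (inside ∷_) (extensions p j)) a∈
... | inj₁ a∈₁ with ∈-map⁻ _ a∈₁
...   | b , b∈ , refl with ∈-extensions⁻ p b j b∈
...     | p⊆b , eq = out⊆ p⊆b , trans (cong suc eq) (sym (+-suc _ j))
∈-extensions⁻ (outside ∷ p) a (suc j) a∈ | inj₂ a∈₂ with ∈-map⁻ _ a∈₂
...   | b , b∈ , refl with ∈-extensions⁻ p b (suc j) b∈
...     | p⊆b , eq = out⊆ p⊆b , eq

unique-extensions : (p : Subset n) (j : ℕ) → Unique (extensions p j)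
unique-extensions [] zero = [] ∷ []
unique-extensions [] (suc j) = []
unique-extensions (inside ∷ p) j = Unique.map⁺ ∷-injectiveʳ (unique-extensions p j)
unique-extensions (outside ∷ p) zero = Unique.map⁺ ∷-injectiveʳ (unique-extensions p zero)
unique-extensions (outside ∷ p) (suc j) =
  Unique.++⁺ (Unique.map⁺ ∷-injectiveʳ (unique-extensions p j))
             (Unique.map⁺ ∷-injectiveʳ (unique-extensions p (suc j)))
             disjoint
  where
  disjoint : ∀ {a} → ¬ (a ∈ map (inside ∷_) (extensions p j) × a ∈ map (outside ∷_) (extensions p (suc j)))
  disjoint (a∈₁ , a∈₂) with ∈-map⁻ _ a∈₁ | ∈-map⁻ _ a∈₂
  ... | _ , _ , eq₁ | _ , _ , eq₂ with ∷-injectiveˡ (trans (sym eq₁) eq₂)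
  ... | ()

-- Membership in the up-set generated by `L`.
_Contains_ : Subset n → List (Subset n) → Set
a Contains L = Any (λ p → p ⊆ a) L

-- Union bound: each `a` in `F` arises from some `p` in `L` by adding `j` of the `n ∸ t` points
-- outside `p`.
cover-bound : (t j : ℕ) (L F : List (Subset n)) → (∀ p → p ∈ L → ∣ p ∣ ≡ t) → Unique F →
  (∀ a → a ∈ F → ∣ a ∣ ≡ t + j × a Contains L) → length F ≤ length L * ((n ∸ t) C j)
cover-bound {n} t j L F sizeL uF h = ≤-trans (length-unique-⊆ uF sub)
  (length-concatMap-≤ (λ p → extensions p j) ((n ∸ t) C j) L
    λ p p∈ → ≤-reflexive (trans (length-extensions p j) (cong (λ m → (n ∸ m) C j) (sizeL p p∈))))
  where
  locate : ∀ {a} (M : List (Subset n)) → (∀ p → p ∈ M → ∣ p ∣ ≡ t) → ∣ a ∣ ≡ t + j → a Contains M →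
           Any (λ p → a ∈ extensions p j) M
  locate {a} (p ∷ M) s eq (here p⊆a) =
    here (∈-extensions⁺ p a j p⊆a (trans eq (cong (_+ j) (sym (s p (here refl))))))
  locate (p ∷ M) s eq (there c) = there (locate M (λ q → s q ∘ there) eq c)
  sub : ∀ {a} → a ∈ F → a ∈ concatMap (λ p → extensions p j) L
  sub {a} a∈ = ∈-concatMap⁺ _ (locate L sizeL (proj₁ (h a a∈)) (proj₂ (h a a∈)))

-- Large intersecting subfamilies of robust independent families

_≟ˢ_ : DecidableEquality (Subset n)
_≟ˢ_ = ≡-dec _≟ᵇ_

filter-filter-⇒ : {P Q : Pred A Level.zero} (P? : Decidable P) (Q? : Decidable Q) →
  (∀ {x} → P x → Q x) → ∀ xs → filter P? (filter Q? xs) ≡ filter P? xs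
filter-filter-⇒ P? Q? imp [] = refl
filter-filter-⇒ P? Q? imp (x ∷ xs) with Q? x
... | yes _ with P? x
...   | yes _ = cong (x ∷_) (filter-filter-⇒ P? Q? imp xs)
...   | no _ = filter-filter-⇒ P? Q? imp xs
filter-filter-⇒ P? Q? imp (x ∷ xs) | no ¬q =
  trans (filter-filter-⇒ P? Q? imp xs) (sym (filter-reject P? (¬q ∘ imp)))

-- Averaging, by induction on `xs`: if the fibre over `x` has at least two elements, deleting it
-- with `x` preserves the strict inequality and leaves the fibres over the other targets unchanged.
small-fibre : (_≟_ : DecidableEquality B) (f : A → B) (xs : List B) (ys : List A) →
  Unique xs → length ys < 2 * length xs →
  ∃ λ u → u ∈ xs × length (filter (λ v → f v ≟ u) ys) ≤ 1
small-fibre _≟_ f (x ∷ xs) ys (x∉ ∷ uxs) lt with length (filter (λ v → f v ≟ x) ys) ≤? 1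
... | yes small = x , here refl , small
... | no big = u , there u∈ , subst (_≤ 1) (cong length same) small
  where
  ys′ = filter (λ v → ¬? (f v ≟ x)) ys
  lt′ : length ys′ < 2 * length xs
  lt′ = +-cancelˡ-< 2 _ _ (begin-strict
    2 + length ys′  ≤⟨ +-monoˡ-≤ (length ys′) (≰⇒> big) ⟩
    length (filter (λ v → f v ≟ x) ys) + length ys′  ≡⟨ sym (length-split (λ v → f v ≟ x) ys) ⟩
    length ys  <⟨ lt ⟩
    2 * suc (length xs) ≡⟨ *-suc 2 (length xs) ⟩
    2 + 2 * length xs ∎)
    where open ≤-Reasoning
  ih = small-fibre _≟_ f xs ys′ uxs lt′
  u = proj₁ ih
  u∈ = proj₁ (proj₂ ih)
  small = proj₂ (proj₂ ih)
  same : filter (λ v → f v ≟ u) ys′ ≡ filter (λ v → f v ≟ u) ys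
  same = filter-filter-⇒ (λ v → f v ≟ u) (λ v → ¬? (f v ≟ x))
    (λ fv≡u fv≡x → All.lookup x∉ u∈ (trans (sym fv≡x) fv≡u)) ys

-- The case `a = b` is included, so every member is nonempty.
Intersecting : List (Subset n) → Set
Intersecting F = ∀ a b → a ∈ F → b ∈ F → Nonempty (a ∩ b)

∩-nonempty : {a b : Subset n} {x : Fin n} → x ∈ₛ a → x ∈ₛ b → Nonempty (a ∩ b)
∩-nonempty {x = x} x∈a x∈b = x , x∈p∩q⁺ (x∈a , x∈b)

∩-nonempty-sym : (a b : Subset n) → Nonempty (a ∩ b) → Nonempty (b ∩ a)
∩-nonempty-sym a b (x , x∈) with x∈p∩q⁻ a b x∈
... | x∈a , x∈b = ∩-nonempty x∈b x∈a

nonempty-of-size : (p : Subset n) → 1 ≤ ∣ p ∣ → Nonempty p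
nonempty-of-size (inside ∷ p) _ = zero , here
nonempty-of-size (outside ∷ p) le with nonempty-of-size p le
... | x , x∈ = suc x , there x∈

length-fromMaybe-≤ : (x : Maybe A) → length (fromMaybe x) ≤ 1
length-fromMaybe-≤ (just x) = s≤s z≤n
length-fromMaybe-≤ nothing = z≤n

∈-fromMaybe : {x : Maybe A} {y : A} → x ≡ just y → y ∈ fromMaybe x
∈-fromMaybe refl = here refl

-- The selected edges form a graph in which every subfamily has at most as many
-- edges as vertices, so some member has degree at most 2; keep it, discard its
-- neighbours, and recurse.
large-intersecting : ∀ {n k} → 1 ≤ k → (s : OneSelection n k) (m : ℕ) (F : List (Subset n)) →
  length F ≤ m → IsFamily n k F → IndependentIn s F →
  ∃ λ I → Unique I × (∀ {a} → a ∈ I → a ∈ F) × Intersecting I × length F ≤ 3 * length I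
large-intersecting 1≤k s m [] _ _ _ = [] , [] , (λ ()) , (λ _ _ ()) , z≤n
large-intersecting {n} {k} 1≤k s (suc m) F@(_ ∷ _) len (uF , vF) ind =
  u ∷ I , All.tabulate (λ a∈ → λ { refl → proj₁ (inF′ a∈) refl }) ∷ uI , sub , inter , bound
  where
  _≟ᵐ_ = Maybe.≡-dec (_≟ˢ_ {n})
  -- With the members of `F` as both sources and targets, the averaging condition reads
  -- `length F < 2 * length F`. It yields a member `u` selected by at most one member.
  fibre : ∃ λ w → w ∈ map just F × length (filter (λ v → sel s v ≟ᵐ w) F) ≤ 1
  fibre = small-fibre _≟ᵐ_ (sel s) (map just F) F (Unique.map⁺ just-injective uF)
    (subst (λ l → length F < 2 * l) (sym (length-map just F)) (m<m+n (length F) (s≤s z≤n)))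
  preimage = ∈-map⁻ just (proj₁ (proj₂ fibre))
  u = proj₁ preimage
  u∈F : u ∈ F
  u∈F = proj₁ (proj₂ preimage)
  incoming = filter (λ v → sel s v ≟ᵐ just u) F
  incoming-small : length incoming ≤ 1
  incoming-small = subst (λ w → length (filter (λ v → sel s v ≟ᵐ w) F) ≤ 1) (proj₂ (proj₂ preimage)) (proj₂ (proj₂ fibre))
  Keep : Subset n → Set
  Keep v = v ≢ u × Nonempty (v ∩ u)
  keep? : Decidable Keep
  keep? v = ¬? (v ≟ˢ u) ×-dec nonempty? (v ∩ u)
  F′ = filter keep? F
  F″ = filter (¬? ∘ keep?) F
  -- A discarded set is `u` itself, the set selected by `u`, or a set selecting `u`. Hence at most
  -- three sets are lost for each one kept, which is the factor 3.
  covered : ∀ {v} → v ∈ F″ → v ∈ u ∷ fromMaybe (sel s u) ++ incoming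
  covered {v} v∈ with ∈-filter⁻ (¬? ∘ keep?) {xs = F} v∈
  ... | v∈F , ¬keep with v ≟ˢ u
  ...   | yes v≡u = here v≡u
  ...   | no v≢u with ind u v u∈F v∈F (All.lookup vF u∈F , All.lookup vF v∈F , λ ne → ¬keep (v≢u , ∩-nonempty-sym u v ne))
  ...     | inj₁ eq = there (∈-++⁺ˡ (∈-fromMaybe eq))
  ...     | inj₂ eq = there (∈-++⁺ʳ (fromMaybe (sel s u)) (∈-filter⁺ (λ w → sel s w ≟ᵐ just u) v∈F eq))
  F″≤3 : length F″ ≤ 3
  F″≤3 = ≤-trans (length-unique-⊆ (Unique.filter⁺ (¬? ∘ keep?) uF) covered)
    (s≤s (≤-trans (≤-reflexive (length-++ (fromMaybe (sel s u)))) (+-mono-≤ (length-fromMaybe-≤ (sel s u)) incoming-small)))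
  shorter : length F′ ≤ m
  shorter = s≤s⁻¹ (≤-trans (filter-notAll keep? F (lose u∈F (λ k → proj₁ k refl))) len)
  F′⊆F : ∀ {a} → a ∈ F′ → a ∈ F
  F′⊆F = proj₁ ∘ ∈-filter⁻ keep?
  ih = large-intersecting 1≤k s m F′ shorter (Unique.filter⁺ keep? uF , All.filter⁺ keep? vF)
         (λ a b a∈ b∈ → ind a b (F′⊆F a∈) (F′⊆F b∈))
  I = proj₁ ih
  uI = proj₁ (proj₂ ih)
  I⊆F′ = proj₁ (proj₂ (proj₂ ih))
  interI = proj₁ (proj₂ (proj₂ (proj₂ ih)))
  inF′ : ∀ {a} → a ∈ I → Keep a
  inF′ a∈ = proj₂ (∈-filter⁻ keep? {xs = F} (I⊆F′ a∈))
  sub : ∀ {a} → a ∈ u ∷ I → a ∈ F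
  sub (here refl) = u∈F
  sub (there a∈) = F′⊆F (I⊆F′ a∈)
  inter : Intersecting (u ∷ I)
  inter a b (here refl) (here refl) with nonempty-of-size u (≤-trans 1≤k (≤-reflexive (sym (All.lookup vF u∈F))))
  ... | x , x∈ = ∩-nonempty x∈ x∈
  inter a b (here refl) (there b∈) = ∩-nonempty-sym b u (proj₂ (inF′ b∈))
  inter a b (there a∈) (here refl) = proj₂ (inF′ a∈)
  inter a b (there a∈) (there b∈) = interI a b a∈ b∈
  bound : length F ≤ 3 * length (u ∷ I)
  bound = begin
    length F               ≡⟨ length-split keep? F ⟩
    length F′ + length F″  ≤⟨ +-mono-≤ (proj₂ (proj₂ (proj₂ (proj₂ ih)))) F″≤3 ⟩
    3 * length I + 3       ≡⟨ +-comm (3 * length I) 3 ⟩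
    3 + 3 * length I       ≡⟨ sym (*-suc 3 (length I)) ⟩
    3 * suc (length I)     ∎
    where open ≤-Reasoning

-- Peeling an intersecting family

∣p∪⁅x⁆∣≡1+∣p∣ : (p : Subset n) (x : Fin n) → x ∉ p → ∣ p ∪ ⁅ x ⁆ ∣ ≡ suc ∣ p ∣
∣p∪⁅x⁆∣≡1+∣p∣ (inside ∷ p) zero x∉ = contradiction here x∉
∣p∪⁅x⁆∣≡1+∣p∣ (outside ∷ p) zero x∉ = cong (suc ∘ ∣_∣) (∪-identityʳ p)
∣p∪⁅x⁆∣≡1+∣p∣ (inside ∷ p) (suc x) x∉ = cong suc (∣p∪⁅x⁆∣≡1+∣p∣ p x (x∉ ∘ there))
∣p∪⁅x⁆∣≡1+∣p∣ (outside ∷ p) (suc x) x∉ = ∣p∪⁅x⁆∣≡1+∣p∣ p x (x∉ ∘ there)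

∪⁅⁆-⊆ : {p a : Subset n} {x : Fin n} → p ⊆ a → x ∈ₛ a → p ∪ ⁅ x ⁆ ⊆ a
∪⁅⁆-⊆ {p = p} {x = x} p⊆a x∈a y∈ with x∈p∪q⁻ p ⁅ x ⁆ y∈
... | inj₁ y∈p = p⊆a y∈p
... | inj₂ y∈x with x∈⁅y⁆⇒x≡y x y∈x
...   | refl = x∈a

⁅x⁆⊆ : {a : Subset n} {x : Fin n} → x ∈ₛ a → ⁅ x ⁆ ⊆ a
⁅x⁆⊆ {x = x} x∈a y∈ with x∈⁅y⁆⇒x≡y x y∈
... | refl = x∈a

∣⁅x⁆∪⁅y⁆∣≡2 : {x y : Fin n} → y ≢ x → ∣ ⁅ x ⁆ ∪ ⁅ y ⁆ ∣ ≡ 2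
∣⁅x⁆∪⁅y⁆∣≡2 {x = x} {y} y≢x =
  trans (∣p∪⁅x⁆∣≡1+∣p∣ ⁅ x ⁆ y (x≢y⇒x∉⁅y⁆ y≢x)) (cong suc (∣⁅x⁆∣≡1 x))

∣p∣<∣q∣⇒∃∈q∉p : (p q : Subset n) → ∣ p ∣ < ∣ q ∣ → ∃ λ x → x ∈ₛ q × x ∉ p
∣p∣<∣q∣⇒∃∈q∉p p q lt with Fin.any? (λ x → (x ∈? q) ×-dec ¬? (x ∈? p))
... | yes found = found
... | no none = contradiction (p⊆q⇒∣p∣≤∣q∣ q⊆p) (<⇒≱ lt)
  where
  q⊆p : q ⊆ p
  q⊆p {x} x∈q with x ∈? p
  ... | yes x∈p = x∈p
  ... | no x∉p = contradiction (x , x∈q , x∉p) none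

∣p∣<2⇒⊆⁅x⁆ : (p : Subset n) {x : Fin n} → x ∈ₛ p → ∣ p ∣ < 2 → p ⊆ ⁅ x ⁆
∣p∣<2⇒⊆⁅x⁆ p {x} x∈p lt {y} y∈p with y Fin.≟ x
... | yes refl = x∈⁅x⁆ y
... | no y≢x = contradiction
  (p⊆q⇒∣p∣≤∣q∣ (∪⁅⁆-⊆ {p = ⁅ x ⁆} (⁅x⁆⊆ x∈p) y∈p))
  (<⇒≱ (≤-trans lt (≤-reflexive (sym (∣⁅x⁆∪⁅y⁆∣≡2 y≢x)))))

-- A set `p` of size below `t` inside some `a` with `W a` misses a member `s` of `S`. Since `a`
-- meets `s`, one of the at most `t` one-point extensions of `p` by elements of `s` still lies in
-- `a`, so each level multiplies the number of candidates by at most `t`.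
branching : (t : ℕ) (S : List (Subset n)) (W : Subset n → Set) →
  (∀ s → s ∈ S → ∣ s ∣ ≤ t) →
  (∀ a s → W a → s ∈ S → Nonempty (a ∩ s)) →
  (∀ a p → W a → p ⊆ a → ∣ p ∣ < t → ∃ λ s → s ∈ S × Empty (p ∩ s)) →
  ∀ j → j ≤ t →
  ∃ λ L → length L ≤ t ^ j × (∀ p → p ∈ L → ∣ p ∣ ≡ j) × (∀ a → W a → a Contains L)
branching {n} t S W size meets missed zero _ =
  ⊥ ∷ [] , s≤s z≤n , (λ { p (here refl) → ∣⊥∣≡0 n }) , λ a _ → here ⊥⊆
branching {n} t S W size meets missed (suc j) j<t =
  concatMap children L , len , sizes , contains
  where
  ih = branching t S W size meets missed j (<⇒≤ j<t)
  L = proj₁ ih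
  Missing? : (p : Subset n) → Dec (Any (λ s → Empty (p ∩ s)) S)
  Missing? p = any? (λ s → ¬? (nonempty? (p ∩ s))) S
  children : Subset n → List (Subset n)
  children p with Missing? p
  ... | yes m = map (λ z → p ∪ ⁅ z ⁆) (elements (proj₁ (find m)))
  -- By `missed`, a candidate that meets all of `S` lies in no `a` with `W a`, so its branch can be
  -- cut.
  ... | no _ = []
  children-length : ∀ p → p ∈ L → length (children p) ≤ t
  children-length p _ with Missing? p
  ... | no _ = z≤n
  ... | yes m = ≤-trans (≤-reflexive (trans (length-map _ (elements s)) (length-elements s))) (size s (proj₁ (proj₂ (find m))))
    where s = proj₁ (find m)
  len : length (concatMap children L) ≤ t ^ suc j
  len = ≤-trans (length-concatMap-≤ children t L children-length)
    (≤-trans (*-monoˡ-≤ t (proj₁ (proj₂ ih))) (≤-reflexive (*-comm (t ^ j) t)))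
  children-size : ∀ p → ∣ p ∣ ≡ j → ∀ q → q ∈ children p → ∣ q ∣ ≡ suc j
  children-size p eq q q∈ with Missing? p
  ... | yes m with ∈-map⁻ _ q∈
  ...   | z , z∈ , refl = trans (∣p∪⁅x⁆∣≡1+∣p∣ p z λ z∈p →
            proj₂ (proj₂ (find m)) (∩-nonempty z∈p (∈-elements⁻ _ z∈))) (cong suc eq)
  sizes : ∀ q → q ∈ concatMap children L → ∣ q ∣ ≡ suc j
  sizes q q∈ with find (∈-concatMap⁻ children {xs = L} q∈)
  ... | p , p∈ , q∈′ = children-size p (proj₁ (proj₂ (proj₂ ih)) p p∈) q q∈′
  extend : ∀ a p → W a → p ⊆ a → ∣ p ∣ ≡ j → a Contains children p
  extend a p wa p⊆a eq with Missing? p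
  ... | no ¬m with missed a p wa p⊆a (≤-trans (≤-reflexive (cong suc eq)) j<t)
  ...   | s , s∈ , e = contradiction (lose s∈ e) ¬m
  extend a p wa p⊆a eq | yes m with meets a (proj₁ (find m)) wa (proj₁ (proj₂ (find m)))
  ... | z , z∈ with x∈p∩q⁻ a (proj₁ (find m)) z∈
  ...   | z∈a , z∈s = lose (∈-map⁺ (λ z → p ∪ ⁅ z ⁆) (∈-elements⁺ z∈s)) (∪⁅⁆-⊆ {p = p} p⊆a z∈a)
  contains : ∀ a → W a → a Contains concatMap children L
  contains a wa with find (proj₂ (proj₂ (proj₂ ih)) a wa)
  ... | p , p∈ , p⊆a with find (extend a p wa p⊆a (proj₁ (proj₂ (proj₂ ih)) p p∈))
  ...   | q , q∈ , q⊆a = lose (∈-concatMap⁺ children (lose p∈ q∈)) q⊆a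

-- The outcome of shrinking generators. `generates` goes in one direction only, since shrinking a
-- generator may enlarge the up-set; `minimal` makes each `big` generator an inclusion-minimal
-- transversal of all generators.
record Compressed (t : ℕ) (Big Small : List (Subset n)) : Set where
  field
    big small : List (Subset n)
    big-size : ∀ s → s ∈ big → ∣ s ∣ ≡ t
    small-size : ∀ s → s ∈ small → ∣ s ∣ < t
    intersecting : Intersecting (big ++ small)
    generates : ∀ a → a Contains (Big ++ Small) → a Contains (big ++ small)
    minimal : ∀ s y → s ∈ big → y ∈ₛ s → ∃ λ s′ → s′ ∈ big ++ small × Empty ((s - y) ∩ s′)

-- While some `s - y` with `s` in `Big` still meets every generator, it replaces `s` and moves to
-- the small side. Each replacement shortens `Big`, whose length is bounded by the fuel `m`.
compress : (t m : ℕ) (Big Small : List (Subset n)) → length Big ≤ m →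
  (∀ s → s ∈ Big → ∣ s ∣ ≡ t) → (∀ s → s ∈ Small → ∣ s ∣ < t) →
  Intersecting (Big ++ Small) → Compressed t Big Small
compress t zero [] Small len big-size small-size inter = record
  { big = [] ; small = Small ; big-size = big-size ; small-size = small-size
  ; intersecting = inter ; generates = λ a c → c ; minimal = λ _ _ () }
compress {n} t (suc m) Big Small len big-size small-size inter
  with any? (λ s → Fin.any? λ y → (y ∈? s) ×-dec all? (λ s′ → nonempty? ((s - y) ∩ s′)) (Big ++ Small)) Big
... | no none = record
  { big = Big ; small = Small ; big-size = big-size ; small-size = small-size
  ; intersecting = inter ; generates = λ a c → c ; minimal = minimal }
  where
  minimal : ∀ s y → s ∈ Big → y ∈ₛ s → ∃ λ s′ → s′ ∈ Big ++ Small × Empty ((s - y) ∩ s′)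
  minimal s y s∈ y∈ = find (All.¬All⇒Any¬ (λ s′ → nonempty? ((s - y) ∩ s′)) (Big ++ Small)
    λ all → none (lose s∈ (y , y∈ , all)))
... | yes some with find some
...   | s , s∈ , y , y∈ , all = record
  { big = big ; small = small ; big-size = bs ; small-size = ss
  ; intersecting = int ; generates = λ a c → gen a (transfer a c) ; minimal = min }
  where
  Big′ = filter (λ r → ¬? (r ≟ˢ s)) Big
  Small′ = (s - y) ∷ Small
  old : ∀ {r} → r ∈ Big′ ++ Small′ → r ≡ s - y ⊎ r ∈ Big ++ Small
  old r∈ with ∈-++⁻ Big′ r∈
  ... | inj₁ r∈B = inj₂ (∈-++⁺ˡ {xs = Big} (proj₁ (∈-filter⁻ (λ r → ¬? (r ≟ˢ s)) {xs = Big} r∈B)))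
  ... | inj₂ (here eq) = inj₁ eq
  ... | inj₂ (there r∈S) = inj₂ (∈-++⁺ʳ Big r∈S)
  small-size′ : ∀ r → r ∈ Small′ → ∣ r ∣ < t
  small-size′ r (here refl) = ≤-trans (x∈p⇒∣p-x∣<∣p∣ y∈) (≤-reflexive (big-size s s∈))
  small-size′ r (there r∈) = small-size r r∈
  -- A common point of `s - y` and the old generator `s` already witnesses that `s - y` is nonempty.
  self : Nonempty ((s - y) ∩ (s - y))
  self with All.lookup all (∈-++⁺ˡ s∈)
  ... | z , z∈ with x∈p∩q⁻ (s - y) s z∈
  ...   | z∈₁ , _ = ∩-nonempty z∈₁ z∈₁
  inter′ : Intersecting (Big′ ++ Small′)
  inter′ a b a∈ b∈ with old a∈ | old b∈
  ... | inj₁ refl | inj₁ refl = self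
  ... | inj₁ refl | inj₂ b∈′ = All.lookup all b∈′
  ... | inj₂ a∈′ | inj₁ refl = ∩-nonempty-sym (s - y) a (All.lookup all a∈′)
  ... | inj₂ a∈′ | inj₂ b∈′ = inter a b a∈′ b∈′
  transfer : ∀ a → a Contains (Big ++ Small) → a Contains (Big′ ++ Small′)
  transfer a c with find c
  ... | r , r∈ , r⊆a with r ≟ˢ s
  ...   | yes refl = lose (∈-++⁺ʳ Big′ (here refl)) (λ x∈ → r⊆a (p─q⊆p r ⁅ y ⁆ x∈))
  ...   | no r≢s with ∈-++⁻ Big r∈
  ...     | inj₁ r∈B = lose (∈-++⁺ˡ (∈-filter⁺ (λ r → ¬? (r ≟ˢ s)) r∈B r≢s)) r⊆a
  ...     | inj₂ r∈S = lose (∈-++⁺ʳ Big′ (there r∈S)) r⊆a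
  rec : Compressed t Big′ Small′
  rec = compress t m Big′ Small′
    (s≤s⁻¹ (≤-trans (filter-notAll (λ r → ¬? (r ≟ˢ s)) Big (lose s∈ (λ r≢ → r≢ refl))) len))
    (λ r r∈ → big-size r (proj₁ (∈-filter⁻ (λ r → ¬? (r ≟ˢ s)) r∈))) small-size′ inter′
  open Compressed rec renaming (big-size to bs; small-size to ss; intersecting to int; generates to gen; minimal to min)

-- Each member contains one of the `∣ U ∣` pairs formed by `x` and a point of `U`; these are genuine
-- pairs because `x ∉ U`.
star-bound : ∀ {ν κ} (x : Fin (2 + ν)) (U : Subset (2 + ν)) (F : List (Subset (2 + ν))) → x ∉ U →
  Unique F → (∀ a → a ∈ F → ∣ a ∣ ≡ 2 + κ × x ∈ₛ a × Nonempty (a ∩ U)) →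
  length F ≤ ∣ U ∣ * (ν C κ)
star-bound {ν} {κ} x U F x∉U uF h = ≤-trans (cover-bound 2 κ L F sizes uF contains)
  (≤-reflexive (cong (_* (ν C κ)) (trans (length-map _ (elements U)) (length-elements U))))
  where
  L = map (λ z → ⁅ x ⁆ ∪ ⁅ z ⁆) (elements U)
  sizes : ∀ p → p ∈ L → ∣ p ∣ ≡ 2
  sizes p p∈ with ∈-map⁻ _ p∈
  ... | z , z∈ , refl = ∣⁅x⁆∪⁅y⁆∣≡2 {x = x} λ { refl → x∉U (∈-elements⁻ U z∈) }
  contains : ∀ a → a ∈ F → ∣ a ∣ ≡ 2 + κ × a Contains L
  contains a a∈ with h a a∈
  ... | size , x∈a , z , z∈ with x∈p∩q⁻ a U z∈
  ...   | z∈a , z∈U = size , lose (∈-map⁺ (λ z → ⁅ x ⁆ ∪ ⁅ z ⁆) (∈-elements⁺ z∈U)) (∪⁅⁆-⊆ {p = ⁅ x ⁆} (⁅x⁆⊆ x∈a) z∈a)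

-- With n = 2 + ν, k = 2 + κ and t = 3 + j, the added layer is t^t C(n-t,k-t). In the base, k comes
-- from a star and 4 = 2^2 from branching on pairs.
peelBound : (ν κ j : ℕ) → ℕ
peelBound ν κ zero = ((2 + κ) ⊔ 4) * (ν C κ)
peelBound ν κ (suc j) = (3 + j) ^ (3 + j) * ((ν ∸ suc j) C (κ ∸ suc j)) + peelBound ν κ j

-- After compression, members of `F` above a `big` generator are counted by branching, and all
-- others lie above a smaller generator, so the induction continues with `small`. The k-sets `b`
-- serve the base case: when all generators share `x`, a `b` avoiding `x` meets the whole star.
peeling : ∀ {ν κ} (j : ℕ) → j ≤ κ → (S F : List (Subset (2 + ν))) →
  Intersecting S → (∀ s → s ∈ S → ∣ s ∣ ≤ 2 + j) → Unique F →
  (∀ a → a ∈ F → ∣ a ∣ ≡ 2 + κ × a Contains S) →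
  (∀ x → ∃ λ b → ∣ b ∣ ≡ 2 + κ × x ∉ b × (∀ a → a ∈ F → Nonempty (a ∩ b))) →
  length F ≤ peelBound ν κ j
peeling {ν} {κ} zero _ S F inter size uF hF transversal
  with Fin.any? (λ x → all? (λ s → x ∈? s) S)
... | yes (x , common) with transversal x
...   | b , ∣b∣ , x∉b , meets = ≤-trans
  (star-bound x b F x∉b uF λ a a∈ → proj₁ (hF a a∈) , x∈ a (proj₂ (hF a a∈)) , meets a a∈)
  (*-monoˡ-≤ (ν C κ) (≤-trans (≤-reflexive ∣b∣) (m≤m⊔n (2 + κ) 4)))
  where
  x∈ : ∀ a → a Contains S → x ∈ₛ a
  x∈ a c with find c
  ... | s , s∈ , s⊆a = s⊆a (All.lookup common s∈)
peeling {ν} {κ} zero _ S F inter size uF hF transversal | no none =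
  ≤-trans (cover-bound 2 κ L F (proj₁ (proj₂ (proj₂ br))) uF λ a a∈ → proj₁ (hF a a∈) , refined a (proj₂ (hF a a∈)))
    (*-monoˡ-≤ (ν C κ) (≤-trans (proj₁ (proj₂ br)) (m≤n⊔m (2 + κ) 4)))
  where
  -- The empty set misses `s` itself; a singleton misses some generator because no point is common
  -- to all of them.
  missed : ∀ s p → s ∈ S → p ⊆ s → ∣ p ∣ < 2 → ∃ λ s′ → s′ ∈ S × Empty (p ∩ s′)
  missed s p s∈ p⊆s lt with nonempty? p
  ... | no empty = s , s∈ , λ (x , x∈) → empty (x , proj₁ (x∈p∩q⁻ p s x∈))
  ... | yes (x , x∈p) with find (All.¬All⇒Any¬ (λ s → x ∈? s) S (λ all → none (x , all)))
  ...   | s′ , s′∈ , x∉s′ = s′ , s′∈ , λ (y , y∈) →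
          let y∈p , y∈s′ = x∈p∩q⁻ p s′ y∈ in
          x∉s′ (subst (_∈ₛ s′) (x∈⁅y⁆⇒x≡y x (∣p∣<2⇒⊆⁅x⁆ p x∈p lt y∈p)) y∈s′)
  -- The branching covers the generators rather than `F`; members of `F` inherit the pairs from the
  -- generators they contain.
  br = branching 2 S (_∈ S) size inter missed 2 ≤-refl
  L = proj₁ br
  refined : ∀ a → a Contains S → a Contains L
  refined a c with find c
  ... | s , s∈ , s⊆a = Any.map (λ p⊆s {x} x∈ → s⊆a (p⊆s x∈)) (proj₂ (proj₂ (proj₂ br)) s s∈)
peeling {ν} {κ} (suc j) j<κ S F inter size uF hF transversal = begin
  length F                   ≡⟨ length-split big? F ⟩
  length F₁ + length F₂      ≤⟨ +-mono-≤ F₁-bound F₂-bound ⟩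
  peelBound ν κ (suc j)      ∎
  where
  open ≤-Reasoning
  t = 3 + j
  isBig? : Decidable (λ (s : Subset (2 + ν)) → ∣ s ∣ ≡ t)
  isBig? s = ∣ s ∣ ≟ t
  Big = filter isBig? S
  Small = filter (¬? ∘ isBig?) S
  unsplit : ∀ {s} → s ∈ Big ++ Small → s ∈ S
  unsplit s∈ with ∈-++⁻ Big s∈
  ... | inj₁ s∈B = proj₁ (∈-filter⁻ isBig? s∈B)
  ... | inj₂ s∈S = proj₁ (∈-filter⁻ (¬? ∘ isBig?) s∈S)
  split : ∀ {s} → s ∈ S → s ∈ Big ++ Small
  split {s} s∈ with isBig? s
  ... | yes b = ∈-++⁺ˡ (∈-filter⁺ isBig? s∈ b)
  ... | no ¬b = ∈-++⁺ʳ Big (∈-filter⁺ (¬? ∘ isBig?) s∈ ¬b)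
  compressed : Compressed t Big Small
  compressed = compress t (length Big) Big Small ≤-refl
    (λ s s∈ → proj₂ (∈-filter⁻ isBig? {xs = S} s∈))
    (λ s s∈ → let s∈S , ¬b = ∈-filter⁻ (¬? ∘ isBig?) {xs = S} s∈ in ≤∧≢⇒< (size s s∈S) ¬b)
    (λ a b a∈ b∈ → inter a b (unsplit a∈) (unsplit b∈))
  open Compressed compressed
  -- For `y` in `s` outside `p`, the set `p` lies in `s - y`, which by minimality misses a
  -- generator.
  missed : ∀ s p → s ∈ big → p ⊆ s → ∣ p ∣ < t → ∃ λ s′ → s′ ∈ big ++ small × Empty (p ∩ s′)
  missed s p s∈ p⊆s lt with ∣p∣<∣q∣⇒∃∈q∉p p s (≤-trans lt (≤-reflexive (sym (big-size s s∈))))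
  ... | y , y∈s , y∉p with minimal s y s∈ y∈s
  ...   | s′ , s′∈ , empty = s′ , s′∈ , λ (z , z∈) →
          let z∈p , z∈s′ = x∈p∩q⁻ p s′ z∈ in
          empty (∩-nonempty (x∈p∧x≢y⇒x∈p-y (p⊆s z∈p) λ { refl → y∉p z∈p }) z∈s′)
  all-size : ∀ s → s ∈ big ++ small → ∣ s ∣ ≤ t
  all-size s s∈ with ∈-++⁻ big s∈
  ... | inj₁ s∈b = ≤-reflexive (big-size s s∈b)
  ... | inj₂ s∈s = <⇒≤ (small-size s s∈s)
  br = branching t (big ++ small) (_∈ big) all-size
    (λ a s a∈ s∈ → intersecting a s (∈-++⁺ˡ a∈) s∈) missed t ≤-refl
  L = proj₁ br
  big? : Decidable (_Contains big)
  big? a = any? (λ p → p ⊆? a) big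
  F₁ = filter big? F
  F₂ = filter (¬? ∘ big?) F
  F₁⊆F : ∀ {a} → a ∈ F₁ → a ∈ F × a Contains big
  F₁⊆F = ∈-filter⁻ big?
  F₂⊆F : ∀ {a} → a ∈ F₂ → a ∈ F × ¬ (a Contains big)
  F₂⊆F = ∈-filter⁻ (¬? ∘ big?)
  refined : ∀ a → a Contains big → a Contains L
  refined a c with find c
  ... | s , s∈ , s⊆a = Any.map (λ p⊆s {x} x∈ → s⊆a (p⊆s x∈)) (proj₂ (proj₂ (proj₂ br)) s s∈)
  F₁-bound : length F₁ ≤ t ^ t * ((ν ∸ suc j) C (κ ∸ suc j))
  F₁-bound = ≤-trans
    (cover-bound t (κ ∸ suc j) L F₁ (proj₁ (proj₂ (proj₂ br))) (Unique.filter⁺ big? uF)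
      λ a a∈ → trans (proj₁ (hF a (proj₁ (F₁⊆F a∈)))) (cong (2 +_) (sym (m+[n∸m]≡n j<κ)))
             , refined a (proj₂ (F₁⊆F a∈)))
    (*-monoˡ-≤ _ (proj₁ (proj₂ br)))
  rest : ∀ a → a Contains S → ¬ (a Contains big) → a Contains small
  rest a c ¬c with find c
  ... | s , s∈ , s⊆a with find (generates a (lose (split s∈) s⊆a))
  ...   | r , r∈ , r⊆a with ∈-++⁻ big r∈
  ...     | inj₁ r∈b = contradiction (lose {P = _⊆ a} r∈b r⊆a) ¬c
  ...     | inj₂ r∈s = lose {P = _⊆ a} r∈s r⊆a
  F₂-bound : length F₂ ≤ peelBound ν κ j
  F₂-bound = peeling j (<⇒≤ j<κ) small F₂
    (λ a b a∈ b∈ → intersecting a b (∈-++⁺ʳ big a∈) (∈-++⁺ʳ big b∈))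
    (λ s s∈ → s≤s⁻¹ (small-size s s∈))
    (Unique.filter⁺ (¬? ∘ big?) uF)
    (λ a a∈ → proj₁ (hF a (proj₁ (F₂⊆F a∈))) , rest a (proj₂ (hF a (proj₁ (F₂⊆F a∈)))) (proj₂ (F₂⊆F a∈)))
    (λ x → let b , ∣b∣ , x∉b , meets = transversal x in b , ∣b∣ , x∉b , λ a a∈ → meets a (proj₁ (F₂⊆F a∈)))

-- Numerical estimates

-- The ratio bound survives lowering both arguments: as `1 ≤ c`, c(κ - j) + j ≤ cκ ≤ ν. So each of
-- the `j` steps gains a factor `c`.
C-descent : ∀ c ν κ → 1 ≤ c → c * κ ≤ ν → ∀ j → j ≤ κ → c ^ j * ((ν ∸ j) C (κ ∸ j)) ≤ ν C κ
C-descent c ν κ 1≤c cκ≤ν zero _ = ≤-reflexive (*-identityˡ _)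
C-descent c ν κ 1≤c cκ≤ν (suc j) j<κ = begin
  c ^ suc j * (ν′ C κ′)   ≡⟨ shuffle c (c ^ j) (ν′ C κ′) ⟩
  c ^ j * (c * (ν′ C κ′)) ≤⟨ *-monoʳ-≤ (c ^ j) (C-step-≤ c ν′ κ′ room) ⟩
  c ^ j * (suc ν′ C suc κ′) ≡⟨ cong₂ (λ a b → c ^ j * (a C b)) (suc-∸ (≤-trans j<κ κ≤ν)) (suc-∸ j<κ) ⟩
  c ^ j * ((ν ∸ j) C (κ ∸ j)) ≤⟨ C-descent c ν κ 1≤c cκ≤ν j (<⇒≤ j<κ) ⟩
  ν C κ ∎
  where
  open ≤-Reasoning
  ν′ = ν ∸ suc j
  κ′ = κ ∸ suc j
  suc-∸ : ∀ {m} → j < m → suc (m ∸ suc j) ≡ m ∸ j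
  suc-∸ lt = sym (+-∸-assoc 1 lt)
  κ≤cκ : ∀ m → m ≤ c * m
  κ≤cκ m = ≤-trans (≤-reflexive (sym (*-identityˡ m))) (*-monoˡ-≤ m 1≤c)
  κ≤ν = ≤-trans (κ≤cκ κ) cκ≤ν
  shuffle : ∀ a b d → a * b * d ≡ b * (a * d)
  shuffle = solve-∀
  room : c * suc κ′ ≤ suc ν′
  room = begin
    c * suc κ′   ≡⟨ cong (c *_) (suc-∸ j<κ) ⟩
    c * (κ ∸ j)  ≤⟨ m+n≤o⇒m≤o∸n (c * (κ ∸ j)) (begin
      c * (κ ∸ j) + j      ≤⟨ +-monoʳ-≤ (c * (κ ∸ j)) (κ≤cκ j) ⟩
      c * (κ ∸ j) + c * j  ≡⟨ sym (*-distribˡ-+ c (κ ∸ j) j) ⟩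
      c * (κ ∸ j + j)      ≡⟨ cong (c *_) (m∸n+n≡m (<⇒≤ j<κ)) ⟩
      c * κ                ≤⟨ cκ≤ν ⟩
      ν                    ∎) ⟩
    ν ∸ j        ≡⟨ sym (suc-∸ (≤-trans j<κ κ≤ν)) ⟩
    suc ν′       ∎

-- Equality holds at `i = 0`, and raising `i` by one at most quadruples the square. This absorbs the
-- two surplus factors of `(2 + i) ^ (2 + i)` in the layer estimate.
[2+i]²≤4*4^i : ∀ i → (2 + i) * (2 + i) ≤ 4 * 4 ^ i
[2+i]²≤4*4^i zero = ≤-refl
[2+i]²≤4*4^i (suc i) = begin
  (3 + i) * (3 + i)              ≤⟨ m≤m+n _ (7 + 10 * i + 3 * (i * i)) ⟩
  (3 + i) * (3 + i) + (7 + 10 * i + 3 * (i * i))  ≡⟨ expand i ⟩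
  4 * ((2 + i) * (2 + i))        ≤⟨ *-monoʳ-≤ 4 ([2+i]²≤4*4^i i) ⟩
  4 * (4 * 4 ^ i)                ∎
  where
  open ≤-Reasoning
  expand : ∀ i → (3 + i) * (3 + i) + (7 + 10 * i + 3 * (i * i)) ≡ 4 * ((2 + i) * (2 + i))
  expand = solve-∀

^-*-distrib : ∀ a b i → (a * b) ^ i ≡ a ^ i * b ^ i
^-*-distrib a b zero = refl
^-*-distrib a b (suc i) = trans (cong (a * b *_) (^-*-distrib a b i)) (shuffle a b (a ^ i) (b ^ i))
  where
  shuffle : ∀ a b c d → a * b * (c * d) ≡ a * c * (b * d)
  shuffle = solve-∀

-- For t = 2 + i ≤ k, t^t = t² t^i ≤ 4 (4k)^i, while the binomial falls by (8k)^i. The quotient of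
-- 8k by 4k leaves the decay 2^(-i).
layer-bound : ∀ ν κ i → 8 * (2 + κ) * κ ≤ ν → i ≤ κ →
  2 ^ i * ((2 + i) ^ (2 + i) * ((ν ∸ i) C (κ ∸ i))) ≤ 4 * (ν C κ)
layer-bound ν κ i le i≤κ = begin
  2 ^ i * ((2 + i) ^ (2 + i) * c)
    ≡⟨ shuffle₁ (2 ^ i) (2 + i) ((2 + i) ^ i) c ⟩
  2 ^ i * c * (((2 + i) * (2 + i)) * (2 + i) ^ i)
    ≤⟨ *-monoʳ-≤ (2 ^ i * c) (*-mono-≤ ([2+i]²≤4*4^i i) (^-monoˡ-≤ i (+-monoʳ-≤ 2 i≤κ))) ⟩
  2 ^ i * c * (4 * 4 ^ i * (2 + κ) ^ i)
    ≡⟨ shuffle₂ (2 ^ i) c (4 ^ i) ((2 + κ) ^ i) ⟩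
  4 * (2 ^ i * 4 ^ i * (2 + κ) ^ i * c)
    ≡⟨ cong (λ e → 4 * (e * c)) (sym (trans (^-*-distrib 8 (2 + κ) i) (cong (_* (2 + κ) ^ i) (^-*-distrib 2 4 i)))) ⟩
  4 * ((8 * (2 + κ)) ^ i * c)
    ≤⟨ *-monoʳ-≤ 4 (C-descent (8 * (2 + κ)) ν κ (s≤s z≤n) le i i≤κ) ⟩
  4 * (ν C κ) ∎
  where
  open ≤-Reasoning
  c = (ν ∸ i) C (κ ∸ i)
  shuffle₁ : ∀ p a q c → p * (a * (a * q) * c) ≡ p * c * ((a * a) * q)
  shuffle₁ = solve-∀
  shuffle₂ : ∀ p c f q → p * c * (4 * f * q) ≡ 4 * (p * f * q * c)
  shuffle₂ = solve-∀

-- The term 4 M on the left is the slack of the geometric series 4 M (1/2 + 1/4 + …).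
peelBound-geometric : ∀ ν κ i → 8 * (2 + κ) * κ ≤ ν → i ≤ κ →
  2 ^ i * peelBound ν κ i + 4 * (ν C κ) ≤ 2 ^ i * (((2 + κ) ⊔ 4 + 4) * (ν C κ))
peelBound-geometric ν κ zero le _ = ≤-reflexive (collect ((2 + κ) ⊔ 4) (ν C κ))
  where
  collect : ∀ m M → 1 * (m * M) + 4 * M ≡ 1 * ((m + 4) * M)
  collect = solve-∀
peelBound-geometric ν κ (suc i) le i<κ = begin
  2 ^ suc i * (c + R) + 4 * M            ≡⟨ expand (2 ^ i) c R M ⟩
  2 ^ suc i * c + (2 * (2 ^ i * R) + 4 * M) ≤⟨ +-monoˡ-≤ _ (layer-bound ν κ (suc i) le i<κ) ⟩
  4 * M + (2 * (2 ^ i * R) + 4 * M)      ≡⟨ collect (2 ^ i * R) M ⟩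
  2 * (2 ^ i * R + 4 * M)                ≤⟨ *-monoʳ-≤ 2 (peelBound-geometric ν κ i le (<⇒≤ i<κ)) ⟩
  2 * (2 ^ i * (m * M))                  ≡⟨ sym (*-assoc 2 (2 ^ i) (m * M)) ⟩
  2 ^ suc i * (m * M)                    ∎
  where
  open ≤-Reasoning
  M = ν C κ
  R = peelBound ν κ i
  m = (2 + κ) ⊔ 4 + 4
  c = (3 + i) ^ (3 + i) * ((ν ∸ suc i) C (κ ∸ suc i))
  expand : ∀ p c R M → 2 * p * (c + R) + 4 * M ≡ 2 * p * c + (2 * (p * R) + 4 * M)
  expand = solve-∀
  collect : ∀ u M → 4 * M + (2 * u + 4 * M) ≡ 2 * (u + 4 * M)
  collect = solve-∀

-- The geometric sum leaves 3(max(k,4) + 4) ≤ 8k, an equality at k = 3 but false at k = 2. For k = 2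
-- there are no layers, and the base alone gives 12 ≤ 16.
3*peelBound≤ : ∀ ν κ → 8 * (2 + κ) * κ ≤ ν → 3 * peelBound ν κ κ ≤ 8 * (2 + κ) * (ν C κ)
3*peelBound≤ ν zero le = ≤-trans (≤-reflexive (sym (*-assoc 3 4 (ν C 0)))) (*-monoˡ-≤ (ν C 0) (m≤m+n 12 4))
3*peelBound≤ ν κ@(suc κ′) le = begin
  3 * peelBound ν κ κ              ≤⟨ *-monoʳ-≤ 3 (*-cancelˡ-≤ (2 ^ κ) {{m^n≢0 2 κ}}
                                       (≤-trans (m≤m+n _ _) (peelBound-geometric ν κ κ le ≤-refl))) ⟩
  3 * (((2 + κ) ⊔ 4 + 4) * (ν C κ)) ≡⟨ sym (*-assoc 3 ((2 + κ) ⊔ 4 + 4) (ν C κ)) ⟩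
  3 * ((2 + κ) ⊔ 4 + 4) * (ν C κ)   ≤⟨ *-monoˡ-≤ (ν C κ) (coefficient κ′) ⟩
  8 * (2 + κ) * (ν C κ)             ∎
  where
  open ≤-Reasoning
  coefficient : ∀ m → 3 * ((3 + m) ⊔ 4 + 4) ≤ 8 * (3 + m)
  coefficient zero = ≤-refl
  coefficient (suc m) = begin
    3 * ((4 + m) ⊔ 4 + 4)  ≡⟨ cong (λ u → 3 * (u + 4)) (m≥n⇒m⊔n≡m (m≤m+n 4 m)) ⟩
    3 * (4 + m + 4)        ≤⟨ m≤m+n _ (8 + 5 * m) ⟩
    3 * (4 + m + 4) + (8 + 5 * m) ≡⟨ expand m ⟩
    8 * (4 + m)            ∎
    where
    expand : ∀ m → 3 * (4 + m + 4) + (8 + 5 * m) ≡ 8 * (4 + m)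
    expand = solve-∀

-- Robust independent families: the star case, the two claims

∣p∪q∣+∣p∩q∣ : (p q : Subset n) → ∣ p ∪ q ∣ + ∣ p ∩ q ∣ ≡ ∣ p ∣ + ∣ q ∣
∣p∪q∣+∣p∩q∣ [] [] = refl
∣p∪q∣+∣p∩q∣ (inside ∷ p) (inside ∷ q) =
  cong suc (trans (+-suc _ _) (trans (cong suc (∣p∪q∣+∣p∩q∣ p q)) (sym (+-suc _ _))))
∣p∪q∣+∣p∩q∣ (inside ∷ p) (outside ∷ q) = cong suc (∣p∪q∣+∣p∩q∣ p q)
∣p∪q∣+∣p∩q∣ (outside ∷ p) (inside ∷ q) = trans (cong suc (∣p∪q∣+∣p∩q∣ p q)) (sym (+-suc _ _))
∣p∪q∣+∣p∩q∣ (outside ∷ p) (outside ∷ q) = ∣p∪q∣+∣p∩q∣ p q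

nonempty⇒1≤ : (p : Subset n) → Nonempty p → 1 ≤ ∣ p ∣
nonempty⇒1≤ p (x , x∈) = ≤-trans (≤-reflexive (sym (∣⁅x⁆∣≡1 x))) (p⊆q⇒∣p∣≤∣q∣ (⁅x⁆⊆ x∈))

-- A member of the star disjoint from both P and Q spends at most one of its two
-- edges itself, so the other one is selected by P or by Q.
robust-star-bound : ∀ {ν κ} (s : OneSelection (2 + ν) (2 + κ)) (x : Fin (2 + ν))
  (P Q : Subset (2 + ν)) (I F : List (Subset (2 + ν))) → 1 ≤ ν C κ →
  IsFamily (2 + ν) (2 + κ) F → IndependentIn s F → Unique I → (∀ {a} → a ∈ I → a ∈ F) →
  (∀ a → a ∈ I → x ∈ₛ a) → P ∈ F → Q ∈ F → P ≢ Q → x ∉ P → x ∉ Q →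
  length I ≤ 2 * (2 + κ) * (ν C κ) + 1
robust-star-bound {ν} {κ} s x P Q I F 1≤M (uF , vF) ind uI I⊆F star P∈ Q∈ P≢Q x∉P x∉Q = begin
  length I                 ≡⟨ length-split meets? I ⟩
  length I₁ + length I₂    ≤⟨ +-monoˡ-≤ (length I₂) I₁-bound ⟩
  ∣ U ∣ * M + length I₂    ≤⟨ total (nonempty? (P ∩ Q)) ⟩
  2 * (2 + κ) * M + 1      ∎
  where
  open ≤-Reasoning
  M = ν C κ
  U = P ∪ Q
  meets? : Decidable (λ (a : Subset (2 + ν)) → Nonempty (a ∩ U))
  meets? a = nonempty? (a ∩ U)
  I₁ = filter meets? I
  I₂ = filter (¬? ∘ meets?) I
  x∉U : x ∉ U
  x∉U x∈ with x∈p∪q⁻ P Q x∈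
  ... | inj₁ x∈P = x∉P x∈P
  ... | inj₂ x∈Q = x∉Q x∈Q
  I₁-bound : length I₁ ≤ ∣ U ∣ * M
  I₁-bound = star-bound x U I₁ x∉U (Unique.filter⁺ meets? uI) λ a a∈ →
    let a∈I , meet = ∈-filter⁻ meets? {xs = I} a∈ in All.lookup vF (I⊆F a∈I) , star a a∈I , meet
  ∣U∣+∣P∩Q∣ : ∣ P ∪ Q ∣ + ∣ P ∩ Q ∣ ≡ 2 * (2 + κ)
  ∣U∣+∣P∩Q∣ = trans (∣p∪q∣+∣p∩q∣ P Q)
    (trans (cong₂ _+_ (All.lookup vF P∈) (All.lookup vF Q∈)) (double (2 + κ)))
    where
    double : ∀ k → k + k ≡ 2 * k
    double = solve-∀
  uI₂ : Unique I₂
  uI₂ = Unique.filter⁺ (¬? ∘ meets?) uI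
  edge : ∀ {h p} → h ∈ I → p ∈ F → Empty (h ∩ p) → Removed s h p
  edge h∈ p∈ e = ind _ _ (I⊆F h∈) p∈ (All.lookup vF (I⊆F h∈) , All.lookup vF p∈ , e)
  selected : ∀ {h} → h ∈ I₂ → x ∈ₛ h × (sel s P ≡ just h ⊎ sel s Q ≡ just h)
  selected {h} h∈ with ∈-filter⁻ (¬? ∘ meets?) {xs = I} h∈
  ... | h∈I , ¬meet = star h h∈I , choose
    (edge h∈I P∈ (λ (y , y∈) → let y∈h , y∈P = x∈p∩q⁻ h P y∈ in ¬meet (∩-nonempty y∈h (p⊆p∪q Q y∈P))))
    (edge h∈I Q∈ (λ (y , y∈) → let y∈h , y∈Q = x∈p∩q⁻ h Q y∈ in ¬meet (∩-nonempty y∈h (q⊆p∪q P Q y∈Q))))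
    where
    choose : Removed s h P → Removed s h Q → sel s P ≡ just h ⊎ sel s Q ≡ just h
    choose (inj₂ eq) _ = inj₁ eq
    choose (inj₁ _) (inj₂ eq) = inj₂ eq
    choose (inj₁ eq₁) (inj₁ eq₂) = contradiction (just-injective (trans (sym eq₁) eq₂)) P≢Q
  -- If `P` and `Q` meet, `U` has at most 2k - 1 points, and the saved `M` pays for a second set in
  -- `I₂`. If they are disjoint, the edge between them uses up the selection of one of them, leaving
  -- at most one set in `I₂`.
  total : Dec (Nonempty (P ∩ Q)) → ∣ U ∣ * M + length I₂ ≤ 2 * (2 + κ) * M + 1
  total (yes meet) = begin
    ∣ U ∣ * M + length I₂    ≤⟨ +-monoʳ-≤ (∣ U ∣ * M) I₂≤2 ⟩
    ∣ U ∣ * M + 2            ≤⟨ +-monoʳ-≤ (∣ U ∣ * M) (+-monoˡ-≤ 1 1≤M) ⟩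
    ∣ U ∣ * M + (M + 1)      ≡⟨ collect ∣ U ∣ M ⟩
    (∣ U ∣ + 1) * M + 1      ≤⟨ +-monoˡ-≤ 1 (*-monoˡ-≤ M (+-monoʳ-≤ ∣ U ∣ (nonempty⇒1≤ (P ∩ Q) meet))) ⟩
    (∣ U ∣ + ∣ P ∩ Q ∣) * M + 1 ≡⟨ cong (λ u → u * M + 1) ∣U∣+∣P∩Q∣ ⟩
    2 * (2 + κ) * M + 1      ∎
    where
    collect : ∀ u M → u * M + (M + 1) ≡ (u + 1) * M + 1
    collect = solve-∀
    I₂≤2 : length I₂ ≤ 2
    I₂≤2 = ≤-trans (length-unique-⊆ uI₂ both)
      (≤-trans (≤-reflexive (length-++ (fromMaybe (sel s P)))) (+-mono-≤ (length-fromMaybe-≤ (sel s P)) (length-fromMaybe-≤ (sel s Q))))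
      where
      both : ∀ {h} → h ∈ I₂ → h ∈ fromMaybe (sel s P) ++ fromMaybe (sel s Q)
      both h∈ with proj₂ (selected h∈)
      ... | inj₁ eq = ∈-++⁺ˡ (∈-fromMaybe eq)
      ... | inj₂ eq = ∈-++⁺ʳ (fromMaybe (sel s P)) (∈-fromMaybe eq)
  total (no disjoint) = +-mono-≤
    (*-monoˡ-≤ M (≤-trans (m≤m+n ∣ U ∣ ∣ P ∩ Q ∣) (≤-reflexive ∣U∣+∣P∩Q∣)))
    (at-most-one (ind P Q P∈ Q∈ (All.lookup vF P∈ , All.lookup vF Q∈ , disjoint)))
    where
    avoids : ∀ {p q h} → x ∉ q → sel s p ≡ just q → x ∈ₛ h → sel s p ≢ just h
    avoids x∉q eq x∈h eq′ with trans (sym eq) eq′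
    ... | refl = x∉q x∈h
    fromQ : sel s P ≡ just Q → ∀ {h} → h ∈ I₂ → h ∈ fromMaybe (sel s Q)
    fromQ eq h∈ with selected h∈
    ... | x∈h , inj₁ eq′ = contradiction eq′ (avoids x∉Q eq x∈h)
    ... | _ , inj₂ eq′ = ∈-fromMaybe eq′
    fromP : sel s Q ≡ just P → ∀ {h} → h ∈ I₂ → h ∈ fromMaybe (sel s P)
    fromP eq h∈ with selected h∈
    ... | _ , inj₁ eq′ = ∈-fromMaybe eq′
    ... | x∈h , inj₂ eq′ = contradiction eq′ (avoids x∉P eq x∈h)
    at-most-one : Removed s P Q → length I₂ ≤ 1
    at-most-one (inj₁ eq) = ≤-trans (length-unique-⊆ uI₂ (fromQ eq)) (length-fromMaybe-≤ (sel s Q))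
    at-most-one (inj₂ eq) = ≤-trans (length-unique-⊆ uI₂ (fromP eq)) (length-fromMaybe-≤ (sel s P))

nonstar-bound : ∀ {ν κ} → 8 * ((2 + κ) * (2 + κ)) ≤ 2 + ν → (F : List (Subset (2 + ν))) →
  IsFamily (2 + ν) (2 + κ) F → RobustIndependent (2 + ν) (2 + κ) F →
  ((x : Fin (2 + ν)) → Σ (Subset (2 + ν)) λ P → Σ (Subset (2 + ν)) λ Q →
    P ∈ F × Q ∈ F × P ≢ Q × x ∉ P × x ∉ Q) →
  length F ≤ 8 * (2 + κ) * (ν C κ)
nonstar-bound {ν} {κ} large F famF@(uF , vF) (s , ind) spread
  with large-intersecting (s≤s z≤n) s (length F) F ≤-refl famF ind
... | I , uI , I⊆F , inter , F≤3I = ≤-trans F≤3I (bound (Fin.any? (λ x → all? (λ a → x ∈? a) I)))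
  where
  open ≤-Reasoning
  k = 2 + κ
  M = ν C κ
  8kκ≤ν : 8 * k * κ ≤ ν
  8kκ≤ν = +-cancelˡ-≤ 2 _ _ (begin
    2 + 8 * k * κ            ≤⟨ +-monoˡ-≤ (8 * k * κ) {2} {16 * k} (s≤s (s≤s z≤n)) ⟩
    16 * k + 8 * k * κ       ≡⟨ collect κ ⟩
    8 * (k * k)              ≤⟨ large ⟩
    2 + ν                    ∎)
    where
    collect : ∀ κ → 16 * (2 + κ) + 8 * (2 + κ) * κ ≡ 8 * ((2 + κ) * (2 + κ))
    collect = solve-∀
  1≤M : 1 ≤ M
  1≤M = C-positive (≤-trans (m≤n*m κ (8 * k)) 8kκ≤ν)
  bound : Dec (∃ λ x → All (x ∈ₛ_) I) → 3 * length I ≤ 8 * k * M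
  bound (yes (x , common)) with spread x
  ... | P , Q , P∈ , Q∈ , P≢Q , x∉P , x∉Q = begin
    3 * length I           ≤⟨ *-monoʳ-≤ 3 (robust-star-bound s x P Q I F 1≤M famF ind uI I⊆F
                                (λ a a∈ → All.lookup common a∈) P∈ Q∈ P≢Q x∉P x∉Q) ⟩
    3 * (2 * k * M + 1)    ≡⟨ expand₁ k M ⟩
    -- Since k ≥ 2 and M ≥ 1, the remainder 3 is at most 2kM.
    6 * k * M + 3          ≤⟨ +-monoʳ-≤ (6 * k * M) (*-mono-≤ {3} {2 * k} (≤-trans (m≤m+n 3 (1 + 2 * κ)) (≤-reflexive (expand₃ κ))) 1≤M) ⟩
    6 * k * M + 2 * k * M  ≡⟨ expand₂ k M ⟩
    8 * k * M              ∎
    where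
    expand₁ : ∀ k M → 3 * (2 * k * M + 1) ≡ 6 * k * M + 3
    expand₁ = solve-∀
    expand₂ : ∀ k M → 6 * k * M + 2 * k * M ≡ 8 * k * M
    expand₂ = solve-∀
    expand₃ : ∀ κ → 3 + (1 + 2 * κ) ≡ 2 * (2 + κ)
    expand₃ = solve-∀
  -- Here `I` generates itself with sets of size k = 2 + κ, so peeling starts at level `κ`. A member
  -- of `I` avoiding `x` meets all of `I`, as the transversals require.
  bound (no none) = ≤-trans (*-monoʳ-≤ 3 (peeling κ ≤-refl I I inter sizes uI
      (λ a a∈ → size a∈ , lose {P = _⊆ a} a∈ (λ x∈ → x∈)) transversal))
    (3*peelBound≤ ν κ 8kκ≤ν)
    where
    size : ∀ {a} → a ∈ I → ∣ a ∣ ≡ k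
    size a∈ = All.lookup vF (I⊆F a∈)
    sizes : ∀ a → a ∈ I → ∣ a ∣ ≤ k
    sizes a a∈ = ≤-reflexive (size a∈)
    transversal : ∀ x → ∃ λ b → ∣ b ∣ ≡ k × x ∉ b × (∀ a → a ∈ I → Nonempty (a ∩ b))
    transversal x with find (All.¬All⇒Any¬ (λ a → x ∈? a) I (λ all → none (x , all)))
    ... | b , b∈ , x∉b = b , size b∈ , x∉b , λ a a∈ → inter a b a∈ b∈

two-distinct : {xs : List (Subset n)} → Unique xs → 2 ≤ length xs →
  ∃ λ a → ∃ λ b → a ∈ xs × b ∈ xs × a ≢ b
two-distinct {xs = a ∷ b ∷ _} ((a≢b ∷ _) ∷ _) _ = a , b , here refl , there (here refl) , a≢b
two-distinct {xs = _ ∷ []} _ (s≤s ())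

robust-upper-bound : ∀ {ν κ} → 8 * ((2 + κ) * (2 + κ)) ≤ 2 + ν → (F : List (Subset (2 + ν))) →
  IsFamily (2 + ν) (2 + κ) F → RobustIndependent (2 + ν) (2 + κ) F →
  length F ≤ suc ν C suc κ + 1
robust-upper-bound {ν} {κ} large F famF@(uF , vF) robust = bound (Fin.all? spread?)
  where
  open ≤-Reasoning
  k = 2 + κ
  missing : Fin (2 + ν) → List (Subset (2 + ν))
  missing x = filter (λ a → ¬? (x ∈? a)) F
  spread? : Decidable (λ x → 2 ≤ length (missing x))
  spread? x = 2 ≤? length (missing x)
  -- This says (n-1)/(k-1) ≥ 8k, the ratio needed to pass from 8k C(n-2,k-2) to C(n-1,k-1).
  8k[1+κ]≤1+ν : 8 * k * suc κ ≤ suc ν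
  8k[1+κ]≤1+ν = s≤s⁻¹ (begin
    1 + 8 * k * suc κ        ≤⟨ +-monoˡ-≤ (8 * k * suc κ) {1} {8 * k} (s≤s z≤n) ⟩
    8 * k + 8 * k * suc κ    ≡⟨ collect κ ⟩
    8 * (k * k)              ≤⟨ large ⟩
    2 + ν                    ∎)
    where
    collect : ∀ κ → 8 * (2 + κ) + 8 * (2 + κ) * suc κ ≡ 8 * ((2 + κ) * (2 + κ))
    collect = solve-∀
  bound : Dec (∀ x → 2 ≤ length (missing x)) → length F ≤ suc ν C suc κ + 1
  bound (yes spread) = begin
    length F            ≤⟨ nonstar-bound large F famF robust pair ⟩
    8 * k * (ν C κ)     ≤⟨ C-step-≤ (8 * k) ν κ 8k[1+κ]≤1+ν ⟩
    suc ν C suc κ       ≤⟨ m≤m+n _ 1 ⟩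
    suc ν C suc κ + 1   ∎
    where
    pair : ∀ x → Σ (Subset (2 + ν)) λ P → Σ (Subset (2 + ν)) λ Q → P ∈ F × Q ∈ F × P ≢ Q × x ∉ P × x ∉ Q
    pair x with two-distinct (Unique.filter⁺ (λ a → ¬? (x ∈? a)) uF) (spread x)
    ... | P , Q , P∈ , Q∈ , P≢Q with ∈-filter⁻ (λ a → ¬? (x ∈? a)) {xs = F} P∈ | ∈-filter⁻ (λ a → ¬? (x ∈? a)) {xs = F} Q∈
    ...   | P∈F , x∉P | Q∈F , x∉Q = P , Q , P∈F , Q∈F , P≢Q , x∉P , x∉Q
  bound (no ¬spread) with Fin.¬∀⟶∃¬ (2 + ν) _ spread? ¬spread
  ... | x , few = begin
    length F                                      ≡⟨ length-split (x ∈?_) F ⟩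
    length (filter (x ∈?_) F) + length (missing x) ≤⟨ +-mono-≤ star≤ (s≤s⁻¹ (≰⇒> few)) ⟩
    suc ν C suc κ + 1                             ∎
    where
    star≤ : length (filter (x ∈?_) F) ≤ suc ν C suc κ
    star≤ = ≤-trans (cover-bound 1 (suc κ) (⁅ x ⁆ ∷ []) (filter (x ∈?_) F) (λ { p (here refl) → ∣⁅x⁆∣≡1 x })
      (Unique.filter⁺ (x ∈?_) uF) λ a a∈ → let a∈F , x∈a = ∈-filter⁻ (x ∈?_) {xs = F} a∈ in
        All.lookup vF a∈F , here (⁅x⁆⊆ x∈a)) (≤-reflexive (*-identityˡ _))

subset-of-size : ∀ {n k} → k ≤ n → ∃ λ (p : Subset n) → ∣ p ∣ ≡ k
subset-of-size {n} z≤n = ⊥ , ∣⊥∣≡0 n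
subset-of-size (s≤s k≤n) with subset-of-size k≤n
... | p , eq = inside ∷ p , cong suc eq

-- The witness is the full star at `zero` plus one set `extra` avoiding `zero`, for which the
-- hypothesis leaves room. Every vertex disjoint from `extra` selects its edge to `extra`, and these
-- are the only edges inside the family.
robust-lower-bound : ∀ {ν κ} → 2 + κ ≤ suc ν →
  Σ (List (Subset (2 + ν))) λ U → IsFamily (2 + ν) (2 + κ) U ×
    RobustIndependent (2 + ν) (2 + κ) U × length U ≡ suc ν C suc κ + 1
robust-lower-bound {ν} {κ} k≤ = extra ∷ star , (extra∉star ∷ unique-extensions ⁅ zero ⁆ (suc κ) , ∣extra∣ ∷ All.tabulate (proj₂ ∘ in-star)) ,
  (record { sel = choice ; valid = choice-valid } , independent) , size
  where
  k = 2 + κ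
  extra : Subset (2 + ν)
  extra = outside ∷ proj₁ (subset-of-size k≤)
  ∣extra∣ : ∣ extra ∣ ≡ k
  ∣extra∣ = proj₂ (subset-of-size k≤)
  star = extensions {2 + ν} ⁅ zero ⁆ (suc κ)
  in-star : ∀ {a} → a ∈ star → zero ∈ₛ a × ∣ a ∣ ≡ k
  in-star {a} a∈ with ∈-extensions⁻ ⁅ zero ⁆ a (suc κ) a∈
  ... | zero⊆ , eq = zero⊆ here , trans eq (cong (_+ suc κ) (∣⁅x⁆∣≡1 {2 + ν} zero))
  extra∉star : All (extra ≢_) star
  extra∉star = All.tabulate λ a∈ extra≡a → contradiction (subst (zero ∈ₛ_) (sym extra≡a) (proj₁ (in-star a∈))) λ ()
  choice : Subset (2 + ν) → Maybe (Subset (2 + ν))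
  choice v with nonempty? (v ∩ extra)
  ... | yes _ = nothing
  ... | no _ = just extra
  choice-valid : ∀ v w → ∣ v ∣ ≡ k → choice v ≡ just w → Adjacent (2 + ν) k v w
  choice-valid v w ∣v∣ eq with nonempty? (v ∩ extra)
  choice-valid v .extra ∣v∣ refl | no empty = ∣v∣ , ∣extra∣ , empty
  chooses-extra : ∀ v → Empty (v ∩ extra) → choice v ≡ just extra
  chooses-extra v empty with nonempty? (v ∩ extra)
  ... | yes ne = contradiction ne empty
  ... | no _ = refl
  independent : ∀ u v → u ∈ extra ∷ star → v ∈ extra ∷ star → Adjacent (2 + ν) k u v → choice u ≡ just v ⊎ choice v ≡ just u
  independent u v u∈ (here refl) (_ , _ , e) = inj₁ (chooses-extra u e)
  independent u v (here refl) (there v∈) (_ , _ , e) = inj₂ (chooses-extra v (e ∘ ∩-nonempty-sym v extra))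
  independent u v (there u∈) (there v∈) (_ , _ , e) =
    contradiction (∩-nonempty (proj₁ (in-star u∈)) (proj₁ (in-star v∈))) e
  size : suc (length star) ≡ suc ν C suc κ + 1
  size = trans (cong suc (trans (length-extensions {2 + ν} ⁅ zero ⁆ (suc κ)) (cong (λ m → (2 + ν ∸ m) C suc κ) (∣⁅x⁆∣≡1 {2 + ν} zero))))
    (+-comm 1 _)

theorem1p6 : (k n : ℕ) → 2 ≤ k → 8 * (k * k) ≤ n →
    α₁KG≡ n k (((n ∸ 1) C (k ∸ 1)) + 1)
    × ((F : List (Subset n)) → IsFamily n k F → RobustIndependent n k F →
    ((x : Fin n) → Σ (Subset n) λ Fx → Σ (Subset n) λ Gx →
    Fx ∈ F × Gx ∈ F × Fx ≢ Gx × x ∉ Fx × x ∉ Gx) →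
    length F ≤ 8 * k * ((n ∸ 2) C (k ∸ 2)))
theorem1p6 (suc (suc κ)) (suc zero) (s≤s (s≤s z≤n)) (s≤s ())
-- Writing k = 2 + κ and n = 2 + ν lets the truncated subtractions in the statement reduce.
theorem1p6 (suc (suc κ)) (suc (suc ν)) (s≤s (s≤s z≤n)) large =
  (robust-lower-bound k≤1+ν , robust-upper-bound large) , nonstar-bound large
  where
  k = 2 + κ
  k≤1+ν : k ≤ suc ν
  k≤1+ν = s≤s⁻¹ (begin
    1 + k        ≤⟨ +-monoˡ-≤ k (s≤s {n = 1 + κ} z≤n) ⟩
    k + k        ≤⟨ +-mono-≤ (m≤m*n k k) (m≤m*n k k) ⟩
    k * k + k * k ≤⟨ +-monoʳ-≤ (k * k) (m≤m+n (k * k) (6 * (k * k))) ⟩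
    8 * (k * k)  ≤⟨ large ⟩
    2 + ν        ∎)
    where open ≤-Reasoning
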